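{- $\mathcal{C}_2(7,3,2)\le 396$.
   Context: $\mathcal{C}_q(n,k,r)$ is the minimum number of $k$-dimensional subspaces of $\mathbb{F}_q^n$ such that every $r$-dimensional subspace of $\mathbb{F}_q^n$ is contained in at least one of them. -}

module Defs where

open import Algebra.Bundles using (CommutativeRing)
open import Algebra.Definitions using (Invertible)
import Algebra.Properties.CommutativeMonoid.Sum as Sum
open import Data.Bool.Base using (Bool; true; false)
open import Data.Bool.Properties using (xor-∧-commutativeRing)
open import Data.Fin.Base using (Fin)
open import Data.Fin.Properties using (2↔Bool)
open import Data.Nat.Base using (ℕ; _≤_)
open import Data.Product.Base using (_×_; _,_; ∃-syntax; Σ-syntax)
open import Data.Vec.Functional using (Vector)
open import Function.Bundles using (Inverse)
open import Function.Construct.Symmetry using (↔-sym)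
open import Level using (0ℓ; suc)
open import Relation.Binary.PropositionalEquality using (_≡_; refl; setoid)
open import Relation.Nullary.Negation using (¬_; contradiction)
open import Relation.Unary using (Pred; _∈_; _⊆_; _≐_)

record FiniteField (q : ℕ) : Set (suc 0ℓ) where
  field
    commutativeRing : CommutativeRing 0ℓ 0ℓ

  open CommutativeRing commutativeRing public hiding (setoid)
  open CommutativeRing commutativeRing using () renaming (setoid to S)

  field
    0≉1         : ¬ 0# ≈ 1#
    invertible  : ∀ x → ¬ x ≈ 0# → Invertible _≈_ 1# _*_ x
    enumeration : Inverse S (setoid (Fin q))

𝔽₂ : FiniteField 2
𝔽₂ = record
  { commutativeRing = xor-∧-commutativeRing
  ; 0≉1             = λ ()
  ; invertible      = λ { false 0≢0 → contradiction refl 0≢0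
                        ; true  _   → true , refl , refl }
  ; enumeration     = ↔-sym 2↔Bool
  }

module LinearAlgebra {q : ℕ} (F : FiniteField q) where

  open FiniteField F using (Carrier; _≈_; _+_; _*_; 0#; +-commutativeMonoid)
  open Sum +-commutativeMonoid using (sum)

  infix 4 _≋_
  _≋_ : ∀ {n} → Vector Carrier n → Vector Carrier n → Set
  u ≋ v = ∀ i → u i ≈ v i

  linearCombination : ∀ {n k} → Vector Carrier k → Vector (Vector Carrier n) k → Vector Carrier n
  linearCombination c b i = sum (λ j → c j * b j i)

  record Subspace (n : ℕ) : Set (suc 0ℓ) where
    field
      carrier  : Pred (Vector Carrier n) 0ℓ
      resp     : ∀ {u v} → u ≋ v → u ∈ carrier → v ∈ carrier
      0∈       : (λ _ → 0#) ∈ carrier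
      +-closed : ∀ {u v} → u ∈ carrier → v ∈ carrier → (λ i → u i + v i) ∈ carrier
      *-closed : ∀ a {v} → v ∈ carrier → (λ i → a * v i) ∈ carrier

  open Subspace public using (carrier)

  LinearlyIndependent : ∀ {n k} → Vector (Vector Carrier n) k → Set
  LinearlyIndependent b = ∀ c → linearCombination c b ≋ (λ _ → 0#) → ∀ j → c j ≈ 0#

  record IsBasis {n k} (U : Subspace n) (b : Vector (Vector Carrier n) k) : Set where
    field
      members     : ∀ j → b j ∈ carrier U
      independent : LinearlyIndependent b
      spanning    : ∀ {v} → v ∈ carrier U → ∃[ c ] v ≋ linearCombination c b

  HasDimension : ∀ {n} → Subspace n → ℕ → Set
  HasDimension {n} U k = Σ[ b ∈ Vector (Vector Carrier n) k ] IsBasis U b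

  -- The family 𝒮 is required to be injective (up to equality of subsets), so
  -- that it is a set of exactly m subspaces.
  record IsCovering (n k r : ℕ) {m : ℕ} (𝒮 : Fin m → Subspace n) : Set (suc 0ℓ) where
    field
      distinct  : ∀ i j → carrier (𝒮 i) ≐ carrier (𝒮 j) → i ≡ j
      dimension : ∀ i → HasDimension (𝒮 i) k
      covers    : ∀ T → HasDimension T r → ∃[ i ] carrier T ⊆ carrier (𝒮 i)

  CoveringOfSize : (n k r m : ℕ) → Set (suc 0ℓ)
  CoveringOfSize n k r m = Σ[ 𝒮 ∈ (Fin m → Subspace n) ] IsCovering n k r 𝒮

-- The covering number 𝒞_q(n,k,r) is given by its graph, since for some
-- parameters no covering exists and there is no minimum.
record Is𝒞 {q : ℕ} (F : FiniteField q) (n k r c : ℕ) : Set (suc 0ℓ) where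
  open LinearAlgebra F using (CoveringOfSize)
  field
    attained : CoveringOfSize n k r c
    minimal  : ∀ m → CoveringOfSize n k r m → c ≤ m

{-# OPTIONS --safe #-}

-- Write 𝔽₂⁷ = 𝔽₂³ × W with W = 𝔽₂⁴.  A line (2-dimensional subspace) disjoint
-- from W lies on a plane {(x, ax + bx²)} with a, b ∈ 𝔽₁₆, x ranging over a
-- 3-dimensional 𝔽₂-subspace of 𝔽₁₆ identified with 𝔽₂³: two values of ax + bx²
-- at independent x determine a and b.  This is a lifted Gabidulin code of 256
-- planes.  For the other lines take a parallelism of PG(3,2), that is, a
-- partition of the 35 lines of W into 7 spreads, and match the spreads with
-- the 7 points u of 𝔽₂³.  The planes ⟨L, (u, w)⟩, with L in the spread of u and
-- w modulo L, cover every line that meets W; there are 7 · 5 · 4 = 140 of them.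
--
-- The minimum exists because covering by the spans of a family of m bases is
-- decidable in m; a family of minimum size has pairwise distinct spans.
module Submission where

open import Defs
import Algebra.Properties.Semiring.Sum as Sum
open import Algebra.Bundles using (CommutativeRing)
open import Data.Bool.Base using (Bool; true; false; _xor_)
open import Data.Fin.Base using (zero; suc; punchIn; punchOut)
open import Data.Fin.Properties as Fin using (all?; any?; punchIn-punchOut)
open import Data.List.Base as List using (List; []; _∷_; [_]; _++_; cartesianProductWith; concatMap; length)
open import Data.List.Membership.Propositional using (_∈_; find)
open import Data.List.Membership.Propositional.Properties using (∈-++⁻; ∈-map⁻; ∈-concatMap⁻; ∈-lookup)
open import Data.List.Relation.Unary.All as All using (All)
open import Data.List.Relation.Unary.Any as Any using (here; there)
open import Data.List.Relation.Unary.Any.Properties using (lookup-index)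
open import Data.Nat.Base using (ℕ; zero; suc; _≤_; _<_)
open import Data.Nat.Induction using (<-wellFounded)
open import Data.Nat.Properties using (anyUpTo?; ≤-refl; ≤-trans; <⇒≤; ≮⇒≥; n<1+n; <⇒≱)
open import Data.Product.Base using (_×_; _,_; ∃; ∃-syntax; proj₁; proj₂; map₂)
open import Data.Sum.Base using (inj₁; inj₂)
open import Data.Vec.Base as Vec using (Vec; []; _∷_; lookup; tabulate; zipWith; replicate)
open import Data.Vec.Functional as Vector using (Vector; head; tail)
open import Data.Vec.Functional.Relation.Binary.Pointwise using (Pointwise)
open import Data.Vec.Properties using (lookup-zipWith; lookup-replicate; lookup∘tabulate)
open import Function.Base using (_∘_)
open import Function.Bundles using (Inverse)
open import Induction.WellFounded using (Acc; acc)
open import Level using (0ℓ)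
open import Relation.Binary.Core using (Rel)
open import Relation.Binary.Definitions using (Reflexive; Symmetric; _Respects_)
open import Relation.Binary.PropositionalEquality using (_≡_; refl; sym; trans; cong; subst)
open import Relation.Nullary.Decidable using (Dec; yes; no; map′; ¬?; _×-dec_; _→-dec_; decidable-stable; toWitness)
open import Relation.Nullary.Negation using (contradiction)
open import Relation.Unary using (Decidable; _⊆_; _≐_)
import Relation.Unary as Unary

-- Exhaustive search over finite types up to an equivalence

-- Vectors are functions here, without extensionality: a search visits only representatives, and
-- their answers settle `P` because `P` respects `_~_`.
Searchable : {A : Set} → Rel A 0ℓ → Set₁
Searchable {A} _~_ = ∀ {P : A → Set} → P Respects _~_ → Decidable P → Dec (∃ P)

module _ {A : Set} {_~_ : Rel A 0ℓ} (search : Searchable _~_) where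

  searchable⇒all? : Symmetric _~_ → ∀ {P : A → Set} → P Respects _~_ → Decidable P → Dec (∀ x → P x)
  searchable⇒all? ~-sym resp P? = map′
    (λ ¬∃¬ x → decidable-stable (P? x) (λ ¬px → ¬∃¬ (x , ¬px)))
    (λ { ∀P (x , ¬px) → ¬px (∀P x) })
    (¬? (search (λ x~y ¬px py → ¬px (resp (~-sym x~y) py)) (¬? ∘ P?)))

  vector-searchable : Reflexive _~_ → ∀ n → Searchable (Pointwise _~_ {n})
  vector-searchable ~-refl zero resp P? = map′
    (Vector.[] ,_)
    (λ (v , pv) → resp (λ ()) pv)
    (P? Vector.[])
  vector-searchable ~-refl (suc n) resp P? = map′
    (λ (x , v , pxv) → x Vector.∷ v , pxv)
    -- `v` is only pointwise equal to the cons of its head and tail, so `resp` has to carry `pv`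
    -- across.
    (λ (v , pv) → head v , tail v , resp (λ { zero → ~-refl ; (suc _) → ~-refl }) pv)
    (search
      (λ x~y → map₂ (resp λ { zero → x~y ; (suc _) → ~-refl }))
      (λ x → vector-searchable ~-refl n
        (λ v~w → resp λ { zero → ~-refl ; (suc i) → v~w i })
        (λ v → P? (x Vector.∷ v))))

-- Descent: a witness below `m` replaces `m`, and when the bounded search finds none, `m` is least.
least : ∀ {P : ℕ → Set} → Decidable P → ∀ {m} → P m →
        ∃[ c ] P c × c ≤ m × (∀ j → P j → c ≤ j)
least {P} P? pm = go pm (<-wellFounded _)
  where
  go : ∀ {m} → P m → Acc _<_ m → ∃[ c ] P c × c ≤ m × (∀ j → P j → c ≤ j)
  go {m} pm (acc rec) with anyUpTo? P? m
  ... | no  ∄n             = m , pm , ≤-refl , λ j pj → ≮⇒≥ λ j<m → ∄n (j , j<m , pj)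
  ... | yes (n , n<m , pn) =
    let c , pc , c≤n , c-min = go pn (rec n<m)
    in  c , pc , ≤-trans c≤n (<⇒≤ n<m) , c-min

-- Coverings given by bases

module Coverings {q : ℕ} (F : FiniteField q) where

  open FiniteField F using (commutativeRing; Carrier; _≈_; _+_; _*_; 0#; 1#; enumeration)
  open CommutativeRing commutativeRing
    using (semiring; +-cong; +-congʳ; *-cong; *-congˡ; *-assoc; zeroˡ; distribʳ; +-identityˡ; +-identityʳ; *-identityˡ)
    renaming (refl to ≈-refl; sym to ≈-sym; trans to ≈-trans)
  open Sum semiring using (sum-cong-≋; sum-replicate-zero; ∑-distrib-+; *-distribˡ-sum)
  open Inverse enumeration using (to; from; strictlyInverseʳ; to-cong; from-cong)
  open LinearAlgebra F

  private variable
    n k r m : ℕ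

  infix 4 _≈?_
  _≈?_ : ∀ x y → Dec (x ≈ y)
  x ≈? y = map′
    (λ eq → ≈-trans (≈-sym (strictlyInverseʳ x)) (≈-trans (from-cong eq) (strictlyInverseʳ y)))
    to-cong
    (to x Fin.≟ to y)

  scalar-searchable : Searchable _≈_
  scalar-searchable resp P? = map′
    (λ (i , p) → from i , p)
    (λ (x , px) → to x , resp (≈-sym (strictlyInverseʳ x)) px)
    (any? (P? ∘ from))

  space-searchable : ∀ n → Searchable (_≋_ {n})
  space-searchable = vector-searchable scalar-searchable ≈-refl

  ≋-sym : Symmetric (_≋_ {n})
  ≋-sym u≋v i = ≈-sym (u≋v i)

  ≋-trans : ∀ {u v w : Vector Carrier n} → u ≋ v → v ≋ w → u ≋ w
  ≋-trans u≋v v≋w i = ≈-trans (u≋v i) (v≋w i)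

  linearCombination-cong : ∀ {c d : Vector Carrier k} {b b′ : Vector (Vector Carrier n) k} →
    c ≋ d → Pointwise _≋_ b b′ → linearCombination c b ≋ linearCombination d b′
  linearCombination-cong c≋d b≋b′ i = sum-cong-≋ λ j → *-cong (c≋d j) (b≋b′ j i)

  Span : Vector (Vector Carrier n) k → Vector Carrier n → Set
  Span b v = ∃[ c ] v ≋ linearCombination c b

  linearCombination-0 : (b : Vector (Vector Carrier n) k) → linearCombination (λ _ → 0#) b ≋ (λ _ → 0#)
  linearCombination-0 {k = k} b i =
    ≈-trans (sum-cong-≋ λ j → zeroˡ (b j i)) (sum-replicate-zero k)

  linearCombination-+ : (c d : Vector Carrier k) (b : Vector (Vector Carrier n) k) →
    (λ i → linearCombination c b i + linearCombination d b i) ≋ linearCombination (λ j → c j + d j) b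
  linearCombination-+ c d b i =
    ≈-trans (≈-sym (∑-distrib-+ (λ j → c j * b j i) (λ j → d j * b j i)))
            (sum-cong-≋ λ j → ≈-sym (distribʳ (b j i) (c j) (d j)))

  linearCombination-* : (a : Carrier) (c : Vector Carrier k) (b : Vector (Vector Carrier n) k) →
    (λ i → a * linearCombination c b i) ≋ linearCombination (λ j → a * c j) b
  linearCombination-* a c b i =
    ≈-trans (*-distribˡ-sum a (λ j → c j * b j i))
            (sum-cong-≋ λ j → ≈-sym (*-assoc a (c j) (b j i)))

  span : Vector (Vector Carrier n) k → Subspace n
  span b = record
    { carrier  = Span b
    ; resp     = λ u≋v (c , u≋cb) → c , ≋-trans (≋-sym u≋v) u≋cb
    ; 0∈       = (λ _ → 0#) , ≋-sym (linearCombination-0 b)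
    ; +-closed = λ (c , u≋cb) (d , v≋db) → (λ j → c j + d j) ,
        ≋-trans (λ i → +-cong (u≋cb i) (v≋db i)) (linearCombination-+ c d b)
    ; *-closed = λ a (c , v≋cb) → (λ j → a * c j) ,
        ≋-trans (λ i → *-congˡ (v≋cb i)) (linearCombination-* a c b)
    }

  generator∈span : (b : Vector (Vector Carrier n) k) → ∀ j → b j Unary.∈ Span b
  generator∈span b zero = (1# Vector.∷ λ _ → 0#) , λ i → ≈-sym
    (≈-trans (+-cong (*-identityˡ (b zero i)) (linearCombination-0 (tail b) i)) (+-identityʳ (b zero i)))
  generator∈span b (suc j) =
    let c , bⱼ≋cb = generator∈span (tail b) j
    in  0# Vector.∷ c , λ i → ≈-trans (bⱼ≋cb i)
          (≈-sym (≈-trans (+-congʳ (zeroˡ (b zero i))) (+-identityˡ (linearCombination c (tail b) i))))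

  span-least : (U : Subspace n) (b : Vector (Vector Carrier n) k) →
               (∀ j → b j Unary.∈ carrier U) → Span b ⊆ carrier U
  span-least U b b∈U (c , v≋cb) = resp (≋-sym v≋cb) (combination∈ c b b∈U)
    where
    open Subspace U using (resp; 0∈; +-closed; *-closed)
    combination∈ : ∀ {k} c (b : Vector (Vector Carrier _) k) →
                   (∀ j → b j Unary.∈ carrier U) → linearCombination c b Unary.∈ carrier U
    combination∈ {zero}  c b b∈U = 0∈
    combination∈ {suc k} c b b∈U =
      +-closed (*-closed (head c) (b∈U zero)) (combination∈ (tail c) (tail b) (b∈U ∘ suc))

  span-dimension : (b : Vector (Vector Carrier n) k) → LinearlyIndependent b → HasDimension (span b) k
  span-dimension b ind = b , record
    { members = generator∈span b ; independent = ind ; spanning = λ v∈ → v∈ }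

  span-resp : ∀ {b b′ : Vector (Vector Carrier n) k} {u v} →
              Pointwise _≋_ b b′ → u ≋ v → u Unary.∈ Span b → v Unary.∈ Span b′
  span-resp b≋b′ u≋v (c , u≋cb) =
    c , ≋-trans (≋-sym u≋v) (≋-trans u≋cb (linearCombination-cong (λ _ → ≈-refl) b≋b′))

  span? : (b : Vector (Vector Carrier n) k) → Decidable (Span b)
  span? b v = space-searchable _
    (λ c≋d v≋cb → ≋-trans v≋cb (linearCombination-cong c≋d λ _ _ → ≈-refl))
    (λ c → all? λ i → v i ≈? linearCombination c b i)

  independent-resp : LinearlyIndependent {n} {k} Respects Pointwise _≋_
  independent-resp b≋b′ ind c cb′≋0 =
    ind c (≋-trans (linearCombination-cong (λ _ → ≈-refl) b≋b′) cb′≋0)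

  independent? : Decidable (LinearlyIndependent {n} {k})
  independent? b = searchable⇒all? (space-searchable _) ≋-sym
    (λ c≋d ind db≋0 j → ≈-trans (≈-sym (c≋d j))
      (ind (≋-trans (linearCombination-cong c≋d λ _ _ → ≈-refl) db≋0) j))
    (λ c → (all? λ i → linearCombination c b i ≈? 0#) →-dec all? λ j → c j ≈? 0#)

  -- Subspaces are arbitrary predicates and cannot be enumerated, whereas tuples of vectors over a
  -- finite field can. Distinctness is left out here and recovered from minimality.
  BasesCover : (n k r : ℕ) → Vector (Vector (Vector Carrier n) k) m → Set
  BasesCover n k r B =
    (∀ i → LinearlyIndependent (B i)) ×
    (∀ (t : Vector (Vector Carrier n) r) → LinearlyIndependent t → ∃[ i ] ∀ j → t j Unary.∈ Span (B i))

  basesCover-resp : BasesCover {m} n k r Respects Pointwise (Pointwise _≋_)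
  basesCover-resp B≋B′ (ind , cov) =
    (λ i → independent-resp (B≋B′ i) (ind i)) ,
    λ t t-ind → map₂ (λ {i} t∈ j → span-resp (B≋B′ i) (λ _ → ≈-refl) (t∈ j)) (cov t t-ind)

  basesCover? : Decidable (BasesCover {m} n k r)
  basesCover? {n = n} {r = r} B =
    all? (independent? ∘ B) ×-dec
    searchable⇒all? (vector-searchable (space-searchable n) (λ _ → ≈-refl) r)
      (λ t≋t′ i j → ≈-sym (t≋t′ i j))
      (λ t≋t′ cov t′-ind →
        map₂ (λ t∈ j → span-resp (λ _ _ → ≈-refl) (t≋t′ j) (t∈ j))
             (cov (independent-resp (λ i j → ≈-sym (t≋t′ i j)) t′-ind)))
      (λ t → independent? t →-dec any? λ i → all? λ j → span? (B i) (t j))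

  HasBasesCover : (n k r m : ℕ) → Set
  HasBasesCover n k r m = ∃[ B ] BasesCover {m} n k r B

  hasBasesCover? : Decidable (HasBasesCover n k r)
  hasBasesCover? {n} {k} m =
    vector-searchable (vector-searchable (space-searchable n) (λ _ → ≈-refl) k) (λ _ _ → ≈-refl) m
      basesCover-resp basesCover?

  -- Turns a minimum over families of bases into a lower bound for all coverings. The member
  -- containing `span t` contains each `t j`, which its chosen basis then spans.
  covering⇒bases : CoveringOfSize n k r m → HasBasesCover n k r m
  covering⇒bases (𝒮 , isCovering) =
    (proj₁ ∘ dimension) ,
    (independent ∘ proj₂ ∘ dimension) ,
    λ t t-ind → map₂ (λ {i} T⊆𝒮ᵢ j → spanning (proj₂ (dimension i)) (T⊆𝒮ᵢ (generator∈span t j)))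
                     (covers (span t) (span-dimension t t-ind))
    where
    open IsCovering isCovering
    open IsBasis

  -- If two members of a minimum family had the same span, deleting one of
  -- them would leave a smaller family.
  minimum⇒distinct : (B : Vector (Vector (Vector Carrier n) k) m) → BasesCover n k r B →
                     (∀ j → HasBasesCover n k r j → m ≤ j) →
                     ∀ i j → Span (B i) ≐ Span (B j) → i ≡ j
  minimum⇒distinct {n = n} {m = suc m} {r = r} B (ind , cov) minimum i j (Bᵢ⊆Bⱼ , _) with i Fin.≟ j
  ... | yes i≡j = i≡j
  ... | no  i≢j = contradiction
    (minimum m (B ∘ punchIn i , ind ∘ punchIn i , λ t t-ind → avoid-i t (cov t t-ind)))
    (<⇒≱ (n<1+n m))
    where
    avoid-i : (t : Vector (Vector Carrier n) r) → ∃[ l ] (∀ s → t s Unary.∈ Span (B l)) →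
              ∃[ l ] (∀ s → t s Unary.∈ Span (B (punchIn i l)))
    avoid-i t (l , t∈Bₗ) with i Fin.≟ l
    -- A tuple assigned to the deleted member `i` is passed on to `j`.
    ... | yes refl = punchOut i≢j ,
      subst (λ l → ∀ s → t s Unary.∈ Span (B l)) (sym (punchIn-punchOut i≢j)) (λ s → Bᵢ⊆Bⱼ (t∈Bₗ s))
    ... | no  i≢l  = punchOut i≢l ,
      subst (λ l → ∀ s → t s Unary.∈ Span (B l)) (sym (punchIn-punchOut i≢l)) t∈Bₗ

  minimum⇒covering : HasBasesCover n k r m → (∀ j → HasBasesCover n k r j → m ≤ j) →
                     CoveringOfSize n k r m
  minimum⇒covering (B , ind , cov) minimum = span ∘ B , record
    { distinct  = minimum⇒distinct B (ind , cov) minimum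
    ; dimension = λ i → span-dimension (B i) (ind i)
    ; covers    = λ T (t , t-basis) → let open IsBasis t-basis in
        map₂ (λ {i} t∈Bᵢ v∈T → span-least (span (B i)) t t∈Bᵢ (spanning v∈T)) (cov t independent)
    }

  bases⇒𝒞 : HasBasesCover n k r m → ∃[ c ] Is𝒞 F n k r c × c ≤ m
  bases⇒𝒞 B =
    let c , C , c≤m , minimum = least hasBasesCover? B
    in  c , record { attained = minimum⇒covering C minimum
                   ; minimal  = λ m → minimum m ∘ covering⇒bases } , c≤m

-- Binary vectors and joins of two points

open LinearAlgebra 𝔽₂
open Coverings 𝔽₂

private variable
  A : Set
  n k : ℕ

pattern O = false
pattern I = true

infixl 6 _⊕_
_⊕_ : Vec Bool n → Vec Bool n → Vec Bool n
_⊕_ = zipWith _xor_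

points : Vec (Vec Bool n) k → List (Vec Bool n)
points []       = [ replicate _ O ]
points (b ∷ bs) = points bs ++ List.map (b ⊕_) (points bs)

-- Concrete planes are first-order data, so that they can be matched on and evaluated; this leads
-- back to the functional vectors of `LinearAlgebra`.
⟦_⟧ : Vec (Vec Bool n) k → Vector (Vector Bool n) k
⟦ bs ⟧ j = lookup (lookup bs j)

points⊆span : ∀ (bs : Vec (Vec Bool n) k) {v} → v ∈ points bs → Span ⟦ bs ⟧ (lookup v)
points⊆span []       (here refl) = Vector.[] , λ i → lookup-replicate i O
points⊆span (b ∷ bs) v∈ with ∈-++⁻ (points bs) v∈
-- With coefficient `O` the term of `b` vanishes by computation, so `eq` fits unchanged.
... | inj₁ v∈bs = let c , eq = points⊆span bs v∈bs in O Vector.∷ c , eq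
... | inj₂ v∈b⊕bs with ∈-map⁻ (b ⊕_) v∈b⊕bs
...   | w , w∈bs , refl = let c , eq = points⊆span bs w∈bs in
  I Vector.∷ c , λ i → trans (lookup-zipWith _xor_ i b w) (cong (lookup b i xor_) (eq i))

-- Bucketing labelled binary vectors coordinate by coordinate

restrict : Bool → List (Vec Bool (suc n) × A) → List (Vec Bool n × A)
restrict x []                  = []
restrict O ((O ∷ v , a) ∷ vas) = (v , a) ∷ restrict O vas
restrict O ((I ∷ v , a) ∷ vas) = restrict O vas
restrict I ((O ∷ v , a) ∷ vas) = restrict I vas
restrict I ((I ∷ v , a) ∷ vas) = (v , a) ∷ restrict I vas

∈-restrict⁻ : ∀ x (vas : List (Vec Bool (suc n) × A)) {v a} →
              (v , a) ∈ restrict x vas → (x ∷ v , a) ∈ vas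
∈-restrict⁻ O ((O ∷ v , a) ∷ vas) (here refl) = here refl
∈-restrict⁻ O ((O ∷ v , a) ∷ vas) (there va∈) = there (∈-restrict⁻ O vas va∈)
∈-restrict⁻ O ((I ∷ v , a) ∷ vas) va∈         = there (∈-restrict⁻ O vas va∈)
∈-restrict⁻ I ((O ∷ v , a) ∷ vas) va∈         = there (∈-restrict⁻ I vas va∈)
∈-restrict⁻ I ((I ∷ v , a) ∷ vas) (here refl) = here refl
∈-restrict⁻ I ((I ∷ v , a) ∷ vas) (there va∈) = there (∈-restrict⁻ I vas va∈)

fibre : List (Vec Bool n × A) → Vec Bool n → List A
fibre vas []      = List.map proj₂ vas
fibre vas (x ∷ v) = fibre (restrict x vas) v

∈-fibre⁻ : ∀ (vas : List (Vec Bool n × A)) v {a} → a ∈ fibre vas v → (v , a) ∈ vas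
∈-fibre⁻ vas []      a∈ with ∈-map⁻ proj₂ a∈
... | ([] , _) , va∈ , refl = va∈
∈-fibre⁻ vas (x ∷ v) a∈ = ∈-restrict⁻ x vas (∈-fibre⁻ (restrict x vas) v a∈)

-- All fibres come from one recursive splitting of the list along the coordinates, instead of a
-- separate pass for every `v`.
allFibres? : {P : List A → Set} → Decidable P → (vas : List (Vec Bool n × A)) →
             Dec (∀ v → P (fibre vas v))
allFibres? {n = zero}  P? vas = map′ (λ { p [] → p }) (λ f → f []) (P? (List.map proj₂ vas))
allFibres? {n = suc n} P? vas = map′
  (λ { (f , g) (O ∷ v) → f v ; (f , g) (I ∷ v) → g v })
  (λ f → f ∘ (O ∷_) , f ∘ (I ∷_))
  (allFibres? P? (restrict O vas) ×-dec allFibres? P? (restrict I vas))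

inhabited? : Decidable (λ (as : List A) → ∃[ a ] a ∈ as)
inhabited? []      = no λ ()
inhabited? (a ∷ _) = yes (a , here refl)

incidences : List (Vec (Vec Bool n) k) → List (Vec Bool n × Vec (Vec Bool n) k)
incidences = concatMap λ b → List.map (_, b) (points b)

∈-incidences⁻ : ∀ (bs : List (Vec (Vec Bool n) k)) {v b} →
                (v , b) ∈ incidences bs → b ∈ bs × v ∈ points b
∈-incidences⁻ bs vb∈ with find (∈-concatMap⁻ (λ b → List.map (_, b) (points b)) vb∈)
... | b , b∈bs , vb∈b with ∈-map⁻ (_, b) vb∈b
...   | v , v∈b , refl = b∈bs , v∈b

-- Bucketing the incidences by points avoids comparing vectors, which keeps
-- the decision procedure below fast enough to be run on 396 planes.
AnyTwoJoined : List (Vec (Vec Bool n) k) → Set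
AnyTwoJoined bs = ∀ u v → ∃[ b ] b ∈ fibre (incidences (fibre (incidences bs) u)) v

anyTwoJoined? : Decidable (AnyTwoJoined {n} {k})
-- `cs` consists of the members through the first vector; their incidences are bucketed again by the
-- second.
anyTwoJoined? bs = allFibres? (λ cs → allFibres? inhabited? (incidences cs)) (incidences bs)

joined⇒bases : (bs : List (Vec (Vec Bool n) k)) → All (LinearlyIndependent ∘ ⟦_⟧) bs →
               AnyTwoJoined bs → HasBasesCover n k 2 (length bs)
joined⇒bases {n} bs ind joined = ⟦_⟧ ∘ List.lookup bs , (λ i → All.lookup ind (∈-lookup i)) , λ t _ → cover t
  where
  cover : (t : Vector (Vector Bool n) 2) → ∃[ i ] ∀ j → Span ⟦ List.lookup bs i ⟧ (t j)
  cover t =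
    let u = tabulate (t zero)
        v = tabulate (t (suc zero))
        b , b∈     = joined u v
        b∈u , v∈b  = ∈-incidences⁻ (fibre (incidences bs) u) (∈-fibre⁻ _ v b∈)
        b∈bs , u∈b = ∈-incidences⁻ bs (∈-fibre⁻ _ u b∈u)
        t∈b : ∀ j → Span ⟦ b ⟧ (t j)
        t∈b = λ { zero       → span-resp (λ _ _ → refl) (lookup∘tabulate (t zero)) (points⊆span b u∈b)
                ; (suc zero) → span-resp (λ _ _ → refl) (lookup∘tabulate (t (suc zero))) (points⊆span b v∈b) }
    in  Any.index b∈bs , subst (λ b → ∀ j → Span ⟦ b ⟧ (t j)) (lookup-index b∈bs) t∈b

-- The 396 planes

vectors : ∀ n → List (Vec Bool n)
vectors zero    = [ [] ]
vectors (suc n) = List.map (O ∷_) (vectors n) ++ List.map (I ∷_) (vectors n)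

-- Multiplication by α in 𝔽₁₆ = 𝔽₂[α]/(α⁴ + α + 1), in the basis 1, α, α², α³.
infixr 8 α·_
α·_ : Vec Bool 4 → Vec Bool 4
α· (a ∷ b ∷ c ∷ d ∷ []) = d ∷ (a xor d) ∷ b ∷ c ∷ []

-- The values of ax + bx² at x = 1, α, α².
gabidulinPlane : Vec Bool 4 → Vec Bool 4 → Vec (Vec Bool 7) 3
gabidulinPlane a b =
  (I ∷ O ∷ O ∷ a ⊕ b) ∷
  (O ∷ I ∷ O ∷ (α· a) ⊕ (α· α· b)) ∷
  (O ∷ O ∷ I ∷ (α· α· a) ⊕ (α· α· α· α· b)) ∷ []

-- Each row is a line of the spread (first two vectors) and a complement of it
-- in W (last two vectors).
spread : List (Vec (Vec Bool 4) 4)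
spread =
  ((O ∷ O ∷ O ∷ I ∷ []) ∷ (O ∷ O ∷ I ∷ O ∷ []) ∷ (O ∷ I ∷ O ∷ O ∷ []) ∷ (I ∷ O ∷ O ∷ O ∷ []) ∷ []) ∷
  ((O ∷ I ∷ O ∷ O ∷ []) ∷ (I ∷ O ∷ O ∷ O ∷ []) ∷ (O ∷ O ∷ O ∷ I ∷ []) ∷ (O ∷ O ∷ I ∷ O ∷ []) ∷ []) ∷
  ((O ∷ I ∷ I ∷ O ∷ []) ∷ (I ∷ O ∷ O ∷ I ∷ []) ∷ (O ∷ O ∷ O ∷ I ∷ []) ∷ (O ∷ O ∷ I ∷ O ∷ []) ∷ []) ∷
  ((O ∷ I ∷ O ∷ I ∷ []) ∷ (I ∷ O ∷ I ∷ I ∷ []) ∷ (O ∷ O ∷ O ∷ I ∷ []) ∷ (O ∷ O ∷ I ∷ O ∷ []) ∷ []) ∷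
  ((O ∷ I ∷ I ∷ I ∷ []) ∷ (I ∷ O ∷ I ∷ O ∷ []) ∷ (O ∷ O ∷ O ∷ I ∷ []) ∷ (O ∷ O ∷ I ∷ O ∷ []) ∷ []) ∷ []

spreadPlanes : Vec (Vec Bool 4) 4 → List (Vec (Vec Bool 7) 3)
spreadPlanes (l ∷ l′ ∷ w ∷ w′ ∷ []) =
  -- The four points of the complement represent W modulo the line. Here u = (1, 0, 0); the other u
  -- are reached by `σ`.
  List.map (λ v → (O ∷ O ∷ O ∷ l) ∷ (O ∷ O ∷ O ∷ l′) ∷ (I ∷ O ∷ O ∷ v) ∷ []) (points (w ∷ w′ ∷ []))

-- Multiplication by β on 𝔽₈ × (𝔽₂ × 𝔽₈), where 𝔽₈ = 𝔽₂[β]/(β³ + β + 1).  The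
-- seven images of the spread under powers of σ form a parallelism of PG(3,2).
σ : Vec Bool 7 → Vec Bool 7
σ (x₀ ∷ x₁ ∷ x₂ ∷ h ∷ y₀ ∷ y₁ ∷ y₂ ∷ []) =
  x₂ ∷ (x₀ xor x₂) ∷ x₁ ∷ h ∷ y₂ ∷ (y₀ xor y₂) ∷ y₁ ∷ []

planes : List (Vec (Vec Bool 7) 3)
planes =
  cartesianProductWith gabidulinPlane (vectors 4) (vectors 4) ++
  -- Powers of `σ` carry (1, 0, 0) to all seven nonzero u, so the 5 · 4 planes over it yield 140.
  concatMap (λ p → List.iterate (Vec.map σ) p 7) (concatMap spreadPlanes spread)

planes-independent : All (LinearlyIndependent ∘ ⟦_⟧) planes
planes-independent = toWitness {a? = All.all? (independent? ∘ ⟦_⟧) planes} _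

-- Evaluation over all 128 · 128 pairs of vectors takes the place of the argument by Gabidulin codes
-- and parallelisms.
planes-joined : AnyTwoJoined planes
planes-joined = toWitness {a? = anyTwoJoined? planes} _

mainTheorem9 : ∃[ c ] (Is𝒞 𝔽₂ 7 3 2 c × c ≤ 396)
mainTheorem9 = bases⇒𝒞 {m = 396} (joined⇒bases planes planes-independent planes-joined)
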